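{- Let $S\neq\mathbb Z_{\ge 0}$ be a numerical semigroup, let $m\in S$ be nonzero, and let $c_1<\dots<c_n$ be the elements of $\mathbb Z_{\ge 0}\setminus S$. Let $p$ be an integer with $0<p\le m$, let $f:\mathbb Z_{\ge 0}\to X$ be an arbitrary function to a set $X$, and let $F(x_1,\dots,x_p)$ be a symmetric function of $p$ variables in $X$ with values in an abelian group. Then $$\sum_{i=1}^n\left(\sum_{J\subset T_i,\ |J|=p-1}F(f\{J\},f(c_i+m))-\sum_{J\subset T_i,\ |J|=p-1}F(f\{J\},f(c_i))\right)=\sum_{I\subset S^{(m)},\ |I|=p}F(f\{I\})-\sum_{I\subset I_m,\ |I|=p}F(f\{I\}).$$ In particular, for $p=m$, $$\sum_{i=1}^n\bigl(F(f\{T_i\},f(c_i+m))-F(f\{T_i\},f(c_i))\bigr)=F(f\{S^{(m)}\})-F(f\{I_m\}).$$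
   Context: A numerical semigroup is a set $S\subset\mathbb Z_{\ge 0}$ that contains $0$, is closed under addition and has finite complement in $\mathbb Z_{\ge 0}$. For a numerical semigroup $S$ and a nonzero $m\in S$, the Apéry set is $S^{(m)}:=\{s\in S: s-m\notin S\}$; it has exactly $m$ elements, one in each residue class mod $m$, and contains $0$. Put $I_m:=\{0,1,\dots,m-1\}$. With $\mathbb Z_{\ge 0}\setminus S=\{c_1<\dots<c_n\}$, let $S_0:=\mathbb Z_{\ge 0}$ and $S_i:=\mathbb Z_{\ge 0}\setminus\{c_1,\dots,c_i\}$ for $i=1,\dots,n$ (so $S_n=S$); each $S_i$ is a numerical semigroup containing $m$. For $i=1,\dots,n$ put $T_i:=S_i^{(m)}\setminus\{c_i+m\}=S_{i-1}^{(m)}\setminus\{c_i\}$, a set of $m-1$ elements. For a finite set $A\subset\mathbb Z_{\ge 0}$, $f\{A\}$ denotes the family $(f(a))_{a\in A}$ of $|A|$ values counted with multiplicity, in any order (the order is irrelevant since $F$ is symmetric, i.e. invariant under all permutations of its arguments); $(f\{J\},u)$ denotes this family with the entry $u$ appended. -}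

module Defs where

open import Algebra.Bundles using (AbelianGroup)
open import Data.Empty using (⊥-elim)
open import Data.Fin.Base as Fin using (Fin; toℕ; fromℕ<)
import Data.Fin.Properties as Fin
open import Data.Fin.Permutation using (Permutation′; _⟨$⟩ʳ_)
open import Data.List.Base as List using (List; []; _∷_; _++_; length; upTo; filter; deduplicate; foldr)
open import Data.List.Properties using (length-tabulate; length-upTo; filter-accept; filter-reject; filter-all)
open import Data.List.Membership.Propositional using (_∈_)
open import Data.List.Membership.Propositional.Properties
  using (∈-filter⁺; ∈-filter⁻; ∈-deduplicate⁺; ∈-++⁺ˡ; ∈-++⁺ʳ; ∈-map⁺; ∈-upTo⁺; ∈-tabulate⁺; ∈-tabulate⁻)
open import Data.List.Membership.Propositional.Properties.WithK using (unique∧set⇒bag)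
open import Data.List.Relation.Binary.BagAndSetEquality using (∼bag⇒↭)
open import Data.List.Relation.Binary.Permutation.Propositional.Properties using (↭-length)
open import Data.List.Relation.Unary.All as All using (All)
open import Data.List.Relation.Unary.AllPairs using (_∷_)
open import Data.List.Relation.Unary.Any using (here; there)
open import Data.List.Relation.Unary.Unique.Propositional using (Unique)
import Data.List.Relation.Unary.Unique.Propositional.Properties as Unique
open import Data.Nat.Base
open import Data.Nat.DivMod using (_%_; _/_; m≡m%n+[m/n]*n; m%n<n; [m+kn]%n≡m%n; m<n⇒m%n≡m; [m+n]%n≡m%n)
open import Data.Nat.ListAction using (sum)
open import Data.Nat.Induction using (<-wellFounded)
open import Data.Nat.Properties
open import Data.List.Relation.Unary.Unique.DecPropositional.Properties _≟_ using (deduplicate-!)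
open import Data.Product using (∃; ∃-syntax; _×_; _,_; proj₁; proj₂)
open import Data.Sum.Base using (inj₁; inj₂)
open import Data.Vec.Base as Vec using (Vec; []; _∷_; _∷ʳ_; lookup; tabulate; cast; fromList)
open import Function.Base using (_∘_)
open import Function.Bundles using (_⇔_; mk⇔; Equivalence)
open import Induction.WellFounded using (Acc; acc)
open import Level using (Level; 0ℓ)
open import Relation.Binary.PropositionalEquality
open import Relation.Binary.Definitions using (tri<; tri≈; tri>)
open import Relation.Nullary using (¬_; Dec; yes; no; ¬?; decidable-stable)
open import Relation.Nullary.Decidable using (_×-dec_; _→-dec_)
open import Relation.Unary using (Pred; Decidable)

private
  variable
    a ℓ x : Level
    A : Set a

Finite : Pred ℕ 0ℓ → Set
Finite P = ∃[ xs ] (∀ {n} → P n → n ∈ xs)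

record FinSet : Set where
  constructor finSet
  field
    elements : List ℕ
    unique   : Unique elements

open FinSet public

size : FinSet → ℕ
size = length ∘ elements

toFinSet : {P : Pred ℕ 0ℓ} → Decidable P → Finite P → FinSet
toFinSet P? (xs , _) = finSet (filter P? (deduplicate _≟_ xs)) (Unique.filter⁺ P? (deduplicate-! xs))

∈-toFinSet : {P : Pred ℕ 0ℓ} (P? : Decidable P) (fin : Finite P) →
             ∀ {n} → n ∈ elements (toFinSet P? fin) ⇔ P n
∈-toFinSet P? (xs , P⊆xs) = mk⇔
  (λ n∈ → proj₂ (∈-filter⁻ P? {xs = deduplicate _≟_ xs} n∈))
  (λ Pn → ∈-filter⁺ P? (∈-deduplicate⁺ _≟_ (P⊆xs Pn)) Pn)

infixl 6 _∖_
_∖_ : FinSet → ℕ → FinSet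
A ∖ n = finSet (filter (λ k → ¬? (k ≟ n)) (elements A)) (Unique.filter⁺ _ (unique A))

I : ℕ → FinSet
I m = finSet (upTo m) (Unique.upTo⁺ m)

I-size : ∀ m → size (I m) ≡ m
I-size = length-upTo

-- The k-element sublists.  As the elements of a FinSet are distinct, each
-- k-element subset J occurs exactly once, as a listing of its elements.
combinations : (k : ℕ) → List A → List (Vec A k)
combinations zero    _        = [] ∷ []
combinations (suc k) []       = []
combinations (suc k) (y ∷ ys) = List.map (y ∷_) (combinations k ys) ++ combinations (suc k) ys

listing : ∀ {k} (A : FinSet) → size A ≡ k → Vec ℕ k
listing A eq = cast eq (fromList (elements A))

record NumericalSemigroup : Set₁ where
  field
    Member     : Pred ℕ 0ℓ
    member?    : Decidable Member
    0-member   : Member 0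
    +-closed   : ∀ {s t} → Member s → Member t → Member (s + t)
    complement-finite : Finite (λ n → ¬ Member n)

open NumericalSemigroup public

infix 4 _∈ₛ_ _∉ₛ_
_∈ₛ_ _∉ₛ_ : ℕ → NumericalSemigroup → Set
n ∈ₛ S = Member S n
n ∉ₛ S = ¬ (n ∈ₛ S)

-- The second component says that the integer s - m is not in S; it holds
-- vacuously when s - m is negative.
IsApéry : NumericalSemigroup → ℕ → Pred ℕ 0ℓ
IsApéry S m s = s ∈ₛ S × (m ≤ s → s ∸ m ∉ₛ S)

isApéry? : ∀ S m → Decidable (IsApéry S m)
isApéry? S m s = member? S s ×-dec ((m ≤? s) →-dec ¬? (member? S (s ∸ m)))

apéry-finite : ∀ S m → Finite (IsApéry S m)
apéry-finite S m = upTo m ++ List.map (_+ m) gs , covers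
  where
  gs = proj₁ (complement-finite S)
  covers : ∀ {s} → IsApéry S m s → s ∈ upTo m ++ List.map (_+ m) gs
  covers {s} (_ , s-m∉S) with m ≤? s
  ... | no  m≰s = ∈-++⁺ˡ (∈-upTo⁺ (≰⇒> m≰s))
  ... | yes m≤s = ∈-++⁺ʳ (upTo m) (subst (_∈ List.map (_+ m) gs) (m∸n+n≡m m≤s)
                    (∈-map⁺ (_+ m) (proj₂ (complement-finite S) (s-m∉S m≤s))))

apéry : NumericalSemigroup → ℕ → FinSet
apéry S m = toFinSet (isApéry? S m) (apéry-finite S m)

∈-apéry : ∀ S m {s} → s ∈ elements (apéry S m) ⇔ IsApéry S m s
∈-apéry S m = ∈-toFinSet (isApéry? S m) (apéry-finite S m)

private
  ∈⇒≤sum : ∀ {n xs} → n ∈ xs → n ≤ sum xs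
  ∈⇒≤sum {xs = y ∷ xs} (here refl) = m≤m+n y (sum xs)
  ∈⇒≤sum {xs = y ∷ xs} (there n∈)  = ≤-trans (∈⇒≤sum n∈) (m≤n+m (sum xs) y)

module _ (S : NumericalSemigroup) (m : ℕ) .{{_ : NonZero m}} (m∈S : m ∈ₛ S) where

  private
    large : ∀ {n} → sum (proj₁ (complement-finite S)) < n → n ∈ₛ S
    large {n} big = decidable-stable (member? S n)
      (λ n∉S → <⇒≱ big (∈⇒≤sum (proj₂ (complement-finite S) n∉S)))

    descend : ∀ s → Acc _<_ s → s ∈ₛ S → ∃[ w ] IsApéry S m w × w % m ≡ s % m
    descend s (acc rs) s∈S with isApéry? S m s
    ... | yes p = s , p , refl
    ... | no ¬p with m ≤? s | member? S (s ∸ m)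
    ...   | no m≰s  | _       = ⊥-elim (¬p (s∈S , λ m≤s → ⊥-elim (m≰s m≤s)))
    ...   | yes m≤s | no s-m∉S = ⊥-elim (¬p (s∈S , λ _ → s-m∉S))
    ...   | yes m≤s | yes s-m∈S with descend (s ∸ m) (rs (∸-monoʳ-< (>-nonZero⁻¹ m) m≤s)) s-m∈S
    ...     | w , p , eq = w , p , trans eq (trans (sym ([m+n]%n≡m%n (s ∸ m) m)) (cong (_% m) (m∸n+n≡m m≤s)))

    representative : ∀ r → ∃[ w ] IsApéry S m w × w % m ≡ r % m
    representative r with descend s (<-wellFounded s) (large big)
      where
      N = suc (sum (proj₁ (complement-finite S)))
      s = r + N * m
      big : N ≤ s
      big = ≤-trans (m≤m*n N m) (m≤n+m (N * m) r)
    ... | w , p , eq = w , p , trans eq ([m+kn]%n≡m%n r (suc (sum (proj₁ (complement-finite S)))) m)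

    +*-closed : ∀ {s} k → s ∈ₛ S → s + k * m ∈ₛ S
    +*-closed {s} zero    s∈S = subst (_∈ₛ S) (sym (+-identityʳ s)) s∈S
    +*-closed {s} (suc k) s∈S = subst (_∈ₛ S) (+-assoc s m (k * m)) (+*-closed k (+-closed S s∈S m∈S))

    congruent-≮ : ∀ {v w} → IsApéry S m v → IsApéry S m w → v % m ≡ w % m → ¬ (v < w)
    congruent-≮ {v} {w} (v∈S , _) (_ , w-m∉S) eq v<w = case
      where
      quotient< : v / m < w / m
      quotient< = ≰⇒> λ w/m≤v/m → <⇒≱ v<w (subst₂ _≤_ (sym (m≡m%n+[m/n]*n w m))
        (sym (trans (m≡m%n+[m/n]*n v m) (cong (_+ (v / m) * m) eq)))
        (+-monoʳ-≤ (w % m) (*-monoˡ-≤ m w/m≤v/m)))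
      d = w / m ∸ suc (v / m)
      w≡ : w ≡ (v + d * m) + m
      w≡ = begin
        w                                    ≡⟨ m≡m%n+[m/n]*n w m ⟩
        w % m + (w / m) * m                  ≡⟨ cong₂ (λ r q → r + q * m) (sym eq) (sym (m∸n+n≡m quotient<)) ⟩
        v % m + (d + suc (v / m)) * m        ≡⟨ cong (v % m +_) (*-distribʳ-+ m d (suc (v / m))) ⟩
        v % m + (d * m + (m + v / m * m))    ≡⟨ cong (v % m +_) (+-comm (d * m) _) ⟩
        v % m + (m + v / m * m + d * m)      ≡⟨ cong (λ t → v % m + (t + d * m)) (+-comm m _) ⟩
        v % m + (v / m * m + m + d * m)      ≡⟨ cong (v % m +_) (+-assoc (v / m * m) m (d * m)) ⟩
        v % m + (v / m * m + (m + d * m))    ≡⟨ sym (+-assoc (v % m) _ _) ⟩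
        v % m + v / m * m + (m + d * m)      ≡⟨ cong (_+ (m + d * m)) (sym (m≡m%n+[m/n]*n v m)) ⟩
        v + (m + d * m)                      ≡⟨ cong (v +_) (+-comm m (d * m)) ⟩
        v + (d * m + m)                      ≡⟨ sym (+-assoc v (d * m) m) ⟩
        (v + d * m) + m                      ∎
        where open ≡-Reasoning
      case = w-m∉S (subst (m ≤_) (sym w≡) (m≤n+m m _))
        (subst (_∈ₛ S) (sym (trans (cong (_∸ m) w≡) (m+n∸n≡m (v + d * m) m))) (+*-closed d v∈S))

    congruent-≡ : ∀ {v w} → IsApéry S m v → IsApéry S m w → v % m ≡ w % m → v ≡ w
    congruent-≡ {v} {w} p q eq with <-cmp v w
    ... | tri< v<w _ _ = ⊥-elim (congruent-≮ p q eq v<w)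
    ... | tri≈ _ v≡w _ = v≡w
    ... | tri> _ _ w<v = ⊥-elim (congruent-≮ q p (sym eq) w<v)

    rep : Fin m → ℕ
    rep i = proj₁ (representative (toℕ i))

    rep-% : ∀ i → rep i % m ≡ toℕ i
    rep-% i = trans (proj₂ (proj₂ (representative (toℕ i)))) (m<n⇒m%n≡m (Fin.toℕ<n i))

    rep-injective : ∀ {i j} → rep i ≡ rep j → i ≡ j
    rep-injective {i} {j} eq = Fin.toℕ-injective
      (trans (sym (rep-% i)) (trans (cong (_% m) eq) (rep-% j)))

    ∈-rep : ∀ {s} → s ∈ List.tabulate rep ⇔ s ∈ elements (apéry S m)
    ∈-rep {s} = mk⇔ to from
      where
      to : s ∈ List.tabulate rep → s ∈ elements (apéry S m)
      to s∈ with i , refl ← ∈-tabulate⁻ s∈ =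
        Equivalence.from (∈-apéry S m) (proj₁ (proj₂ (representative (toℕ i))))
      from : s ∈ elements (apéry S m) → s ∈ List.tabulate rep
      from s∈ = subst (_∈ List.tabulate rep)
        (congruent-≡ (proj₁ (proj₂ (representative (toℕ i)))) (Equivalence.to (∈-apéry S m) s∈)
          (trans (rep-% i) (Fin.toℕ-fromℕ< _)))
        (∈-tabulate⁺ i)
        where i = fromℕ< (m%n<n s m)

  apéry-size : size (apéry S m) ≡ m
  apéry-size = trans
    (sym (↭-length (∼bag⇒↭ (unique∧set⇒bag (Unique.tabulate⁺ rep-injective) (unique (apéry S m)) ∈-rep))))
    (length-tabulate rep)

private
  length-remove : ∀ {n xs} → Unique xs → n ∈ xs → suc (length (filter (λ k → ¬? (k ≟ n)) xs)) ≡ length xs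
  length-remove {n} {y ∷ xs} (y∉xs ∷ _) (here refl)
    rewrite filter-reject (λ k → ¬? (k ≟ n)) {xs = xs} (λ n≢n → n≢n refl) =
    cong (suc ∘ length) (filter-all (λ k → ¬? (k ≟ n)) (All.map (λ n≢k k≡n → n≢k (sym k≡n)) y∉xs))
  length-remove {n} {y ∷ xs} (y∉xs ∷ u) (there n∈)
    rewrite filter-accept (λ k → ¬? (k ≟ n)) {xs = xs} (All.lookup y∉xs n∈) =
    cong suc (length-remove u n∈)

-- Indexing is from zero: the gaps c₁ < … < cₙ are c 0, …, c (n - 1).
record IsGapEnumeration (S : NumericalSemigroup) {n : ℕ} (c : Fin n → ℕ) : Set where
  field
    increasing : ∀ {i j} → i Fin.< j → c i < c j
    enumerates : ∀ k → k ∉ₛ S ⇔ (∃[ i ] c i ≡ k)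

module Chain (S : NumericalSemigroup) (m : ℕ) .{{_ : NonZero m}} (m∈S : m ∈ₛ S)
             {n : ℕ} (c : Fin n → ℕ) (gaps : IsGapEnumeration S c) where

  open IsGapEnumeration gaps

  private
    monotone : ∀ {i j} → c i < c j → i Fin.< j
    monotone {i} {j} ci<cj with Fin.<-cmp i j
    ... | tri< i<j _ _  = i<j
    ... | tri≈ _ refl _ = ⊥-elim (<-irrefl refl ci<cj)
    ... | tri> _ _ j<i  = ⊥-elim (<-asym ci<cj (increasing j<i))

  -- Sₖ : the complement of the k smallest gaps
  InChain : ℕ → Pred ℕ 0ℓ
  InChain k t = ∀ j → toℕ j < k → t ≢ c j

  private
    inChain? : ∀ k → Decidable (InChain k)
    inChain? k t = Fin.all? λ j → (toℕ j <? k) →-dec ¬? (t ≟ c j)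

    S⊆chain : ∀ k {t} → t ∈ₛ S → InChain k t
    S⊆chain k t∈S j _ refl = Equivalence.from (enumerates (c j)) (j , refl) t∈S

    chain-small : ∀ k {t j} → InChain k t → toℕ j < k → t ≤ c j → t ∈ₛ S
    chain-small k {t} {j} t∈ j<k t≤cj = decidable-stable (member? S t) λ t∉S → absurd t∉S
      where
      absurd : ¬ (t ∉ₛ S)
      absurd t∉S with Equivalence.to (enumerates t) t∉S
      ... | i , refl with m≤n⇒m<n∨m≡n t≤cj
      ...   | inj₁ ci<cj = t∈ i (<-trans (monotone ci<cj) j<k) refl
      ...   | inj₂ ci≡cj = t∈ j j<k ci≡cj

  chain : ℕ → NumericalSemigroup
  chain k .Member   = InChain k
  chain k .member?  = inChain? k
  chain k .0-member = S⊆chain k (0-member S)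
  chain k .+-closed {s} {t} s∈ t∈ j j<k s+t≡cj = S⊆chain k
    (+-closed S (chain-small k s∈ j<k (subst (s ≤_) s+t≡cj (m≤m+n s t)))
                (chain-small k t∈ j<k (subst (t ≤_) s+t≡cj (m≤n+m t s))))
    j j<k s+t≡cj
  chain k .complement-finite = List.tabulate c , covers
    where
    covers : ∀ {t} → ¬ InChain k t → t ∈ List.tabulate c
    covers {t} t∉ with Equivalence.to (enumerates t) (λ t∈S → t∉ (S⊆chain k t∈S))
    ... | i , refl = ∈-tabulate⁺ i

  -- As c is indexed from zero while Sₖ = chain k is not, the semigroup belonging
  -- to the gap c i is chain (suc (toℕ i)).
  T : Fin n → FinSet
  T i = apéry (chain (suc (toℕ i))) m ∖ (c i + m)

  private
    c+m∈apéry : ∀ i → IsApéry (chain (suc (toℕ i))) m (c i + m)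
    c+m∈apéry i = c+m∈ , λ _ c∈ → c∈ i ≤-refl (m+n∸n≡m (c i) m)
      where
      c<c+m : c i < c i + m
      c<c+m = m<m+n (c i) (>-nonZero⁻¹ m)
      c+m∈ : InChain (suc (toℕ i)) (c i + m)
      c+m∈ j j<1+i c+m≡cj = <⇒≱ (monotone (subst (c i <_) c+m≡cj c<c+m)) (s≤s⁻¹ j<1+i)

  T-size : ∀ i → size (T i) ≡ pred m
  T-size i = cong pred (trans
    (length-remove (unique (apéry (chain (suc (toℕ i))) m)) (Equivalence.from (∈-apéry (chain (suc (toℕ i))) m) (c+m∈apéry i)))
    (apéry-size (chain (suc (toℕ i))) m (S⊆chain (suc (toℕ i)) m∈S)))

-- Takes pred p entries rather than fixing p = suc q, so that p stays a variable.
append : {X : Set x} {p : ℕ} .{{_ : NonZero p}} → Vec X (pred p) → X → Vec X p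
append {p = suc _} xs u = xs ∷ʳ u

module _ (G : AbelianGroup a ℓ) where

  open AbelianGroup G

  IsSymmetric : {X : Set x} {p : ℕ} → (Vec X p → Carrier) → Set _
  IsSymmetric {p = p} F = ∀ (π : Permutation′ p) xs → F (tabulate (λ i → lookup xs (π ⟨$⟩ʳ i))) ≈ F xs

  sumSubsets : (A : FinSet) (k : ℕ) → (Vec ℕ k → Carrier) → Carrier
  sumSubsets A k g = foldr (λ J s → g J ∙ s) ε (combinations k (elements A))

{-# OPTIONS --safe #-}

-- Passing from Sᵢ₋₁ to Sᵢ replaces the entry cᵢ of the Apéry set by cᵢ + m and
-- keeps Tᵢ.  Splitting the p-subsets of Tᵢ ∪ {u} according to whether they
-- contain u therefore turns the i-th summand into the difference of the sums
-- over the p-subsets of the two Apéry sets, and the total telescopes from the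
-- Apéry set I_m of S₀ to that of Sₙ = S.
module Submission where

open import Defs
open import Algebra.Bundles using (AbelianGroup)
open import Algebra.Properties.CommutativeMonoid.Sum using (sum)
open import Data.Fin.Base using (Fin)
open import Data.Nat.Base using (ℕ; NonZero; _+_; _≤_; pred)
open import Data.Product using (_×_)
open import Data.Vec.Base using (Vec; map)
open import Level using (Level)
open import Relation.Nullary using (¬_)

import Algebra.Properties.AbelianGroup as AbelianGroupProperties
import Algebra.Properties.CommutativeMonoid.Sum as Sum
import Algebra.Properties.CommutativeSemigroup as CommutativeSemigroupProperties
open import Data.Empty using (⊥-elim)
open import Data.Fin.Base using (zero; suc; toℕ)
open import Data.Fin.Permutation using (lift₀; swap; id)
open import Data.Fin.Properties using (toℕ<n; toℕ-injective)
open import Data.List.Base as List using (List; []; _∷_; _++_; length; foldr)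
open import Data.List.Membership.Propositional using (_∈_)
open import Data.List.Membership.Propositional.Properties using (∈-filter⁺; ∈-filter⁻; ∈-upTo⁺; ∈-upTo⁻)
open import Data.List.Membership.Propositional.Properties.WithK using (unique∧set⇒bag)
open import Data.List.Properties using (foldr-++; foldr-map)
open import Data.List.Relation.Binary.BagAndSetEquality using (∼bag⇒↭)
open import Data.List.Relation.Binary.Permutation.Propositional as Perm using (_↭_)
import Data.List.Relation.Unary.All as All
open import Data.List.Relation.Unary.AllPairs using (_∷_)
open import Data.List.Relation.Unary.Any using (here; there)
open import Data.List.Relation.Unary.Unique.Propositional using (Unique)
open import Data.Nat.Base using (zero; suc; _<_; _∸_; s≤s; s≤s⁻¹; >-nonZero⁻¹)
open import Data.Nat.Properties
  using (_≟_; ≤-refl; ≤-reflexive; ≤-trans; n≤1+n; <-irrefl; <-asym; <-cmp; <⇒≱; ≰⇒>; m≤n⇒m<n∨m≡n; suc-injective;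
         m<m+n; m≤n+m; m+n∸n≡m; m∸n+n≡m; ∸-monoʳ-<)
open import Data.Product using (_,_; proj₁; proj₂)
open import Data.Sum.Base using (_⊎_; inj₁; inj₂)
open import Data.Vec.Base using ([]; _∷_; _∷ʳ_; lookup; cast; fromList)
open import Data.Vec.Functional.Relation.Binary.Permutation using () renaming (_↭_ to _↭ᶠ_)
open import Data.Vec.Functional.Relation.Binary.Permutation.Properties using () renaming (↭-trans to ↭ᶠ-trans)
open import Data.Vec.Properties using (lookup-map; lookup∘tabulate; tabulate-cong; tabulate∘lookup)
open import Function.Base using (_∘_)
open import Function.Bundles using (_⇔_; mk⇔; Equivalence)
open import Relation.Binary.Definitions using (tri<; tri≈; tri>)
open import Relation.Binary.PropositionalEquality as ≡ using (_≡_; _≢_; refl; subst)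
open import Relation.Nullary using (yes; no; ¬?; decidable-stable)

private
  variable
    a ℓ x : Level
    A X Y : Set a
    k : ℕ

-- Rearrangements of vectors.

∷-↭ᶠ : ∀ y {xs ys : Vec A k} → lookup xs ↭ᶠ lookup ys → lookup (y ∷ xs) ↭ᶠ lookup (y ∷ ys)
∷-↭ᶠ y (π , eq) = lift₀ π , λ { zero → refl ; (suc i) → eq i }

swap-↭ᶠ : ∀ y z (xs : Vec A k) → lookup (y ∷ z ∷ xs) ↭ᶠ lookup (z ∷ y ∷ xs)
swap-↭ᶠ y z xs = swap id , λ { zero → refl ; (suc zero) → refl ; (suc (suc i)) → refl }

-- Reconciles `append`, which puts the new value last, with `combinations`, which puts it first. By
-- induction, `u` moves to the front of the tail and is then swapped with the head.
∷ʳ-↭ᶠ-∷ : ∀ (xs : Vec A k) u → lookup (xs ∷ʳ u) ↭ᶠ lookup (u ∷ xs)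
∷ʳ-↭ᶠ-∷ []       u = id , λ _ → refl
∷ʳ-↭ᶠ-∷ (y ∷ xs) u = ↭ᶠ-trans {i = _} {_} {_} {lookup (y ∷ (xs ∷ʳ u))} {_} {lookup (u ∷ y ∷ xs)}
  (∷-↭ᶠ y {xs ∷ʳ u} {u ∷ xs} (∷ʳ-↭ᶠ-∷ xs u)) (swap-↭ᶠ y u xs)

-- Finite sets as duplicate-free lists.

-- Apéry sets are compared by membership, whereas sums run over their listings; this is the passage
-- from the former to the latter.
unique∧set⇒↭ : {xs ys : List A} → Unique xs → Unique ys → (∀ {z} → z ∈ xs ⇔ z ∈ ys) → xs ↭ ys
unique∧set⇒↭ xs! ys! xs∼ys = ∼bag⇒↭ (unique∧set⇒bag xs! ys! xs∼ys)

∈-∖ : ∀ B {u t} → t ∈ elements (B ∖ u) ⇔ (t ∈ elements B × t ≢ u)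
∈-∖ B = mk⇔ (∈-filter⁻ (λ k → ¬? (k ≟ _))) λ (t∈ , t≢u) → ∈-filter⁺ _ t∈ t≢u

∖-insert : ∀ B {u} → u ∈ elements B → elements B ↭ u ∷ elements (B ∖ u)
∖-insert B {u} u∈B = unique∧set⇒↭ (unique B)
  (All.tabulate (λ t∈ u≡t → proj₂ (Equivalence.to (∈-∖ B) t∈) (≡.sym u≡t)) ∷ unique (B ∖ u))
  (mk⇔ to from)
  where
  to : ∀ {t} → t ∈ elements B → t ∈ u ∷ elements (B ∖ u)
  to {t} t∈ with t ≟ u
  ... | yes t≡u = here t≡u
  ... | no  t≢u = there (Equivalence.from (∈-∖ B) (t∈ , t≢u))
  from : ∀ {t} → t ∈ u ∷ elements (B ∖ u) → t ∈ elements B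
  from (here refl) = u∈B
  from (there t∈)  = proj₁ (Equivalence.to (∈-∖ B) t∈)

-- Sublists of full or excessive length.

combinations-oversized : ∀ (xs : List A) {k} → length xs < k → combinations k xs ≡ []
combinations-oversized []       {suc k} _ = refl
combinations-oversized (y ∷ xs) {suc k} (s≤s xs<k)
  rewrite combinations-oversized xs xs<k | combinations-oversized xs {suc k} (≤-trans xs<k (n≤1+n k)) = refl

-- The head must be taken: once it is omitted, too few elements remain.
combinations-full : ∀ (xs : List A) (eq : length xs ≡ k) → combinations k xs ≡ cast eq (fromList xs) ∷ []
combinations-full {k = zero}  []       eq = refl
combinations-full {k = suc k} (y ∷ xs) eq
  rewrite combinations-full xs (suc-injective eq)
        | combinations-oversized xs {suc k} (s≤s (≤-reflexive (suc-injective eq))) = refl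

-- Symmetric functions with values in an abelian group.

module _ (G : AbelianGroup a ℓ) where

  open AbelianGroup G renaming (refl to ≈-refl; sym to ≈-sym; trans to ≈-trans)
  open AbelianGroupProperties G using (⁻¹-∙-comm; //-rightDividesˡ)
  open CommutativeSemigroupProperties commutativeSemigroup using (interchange; x∙yz≈y∙xz)
  open import Relation.Binary.Reasoning.Setoid setoid

  IsSymmetric-↭ᶠ : {F : Vec X k → Carrier} → IsSymmetric G F →
                   ∀ {xs ys} → lookup xs ↭ᶠ lookup ys → F xs ≈ F ys
  IsSymmetric-↭ᶠ {F = F} sym {xs} {ys} (π , eq) = ≈-trans (≈-sym (sym π xs))
    (reflexive (≡.cong F (≡.trans (tabulate-cong eq) (tabulate∘lookup ys))))

  -- Together with its converse `IsSymmetric-↭ᶠ`, this replaces symmetry by invariance under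
  -- relating two given vectors, so the closure properties below need no `tabulate`.
  ↭ᶠ-IsSymmetric : {F : Vec X k → Carrier} →
                   (∀ {xs ys} → lookup xs ↭ᶠ lookup ys → F xs ≈ F ys) → IsSymmetric G F
  ↭ᶠ-IsSymmetric resp π xs = ≈-sym (resp (π , λ i → ≡.sym (lookup∘tabulate _ i)))

  -- A permutation of the tail extends to one fixing the head. Inductions over lists need this
  -- because the sublists containing `y` contribute values of `F (y ∷ _)`.
  IsSymmetric-∷ : {F : Vec X (suc k) → Carrier} → IsSymmetric G F → ∀ y → IsSymmetric G (λ xs → F (y ∷ xs))
  IsSymmetric-∷ sym y = ↭ᶠ-IsSymmetric λ {xs} {ys} xs↭ys → IsSymmetric-↭ᶠ sym (∷-↭ᶠ y {xs} {ys} xs↭ys)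

  IsSymmetric-map : {F : Vec Y k → Carrier} → IsSymmetric G F →
                    ∀ (f : X → Y) → IsSymmetric G (λ xs → F (map f xs))
  IsSymmetric-map sym f = ↭ᶠ-IsSymmetric λ {xs} {ys} (π , eq) → IsSymmetric-↭ᶠ sym
    (π , λ i → ≡.trans (lookup-map _ f xs) (≡.trans (≡.cong f (eq i)) (≡.sym (lookup-map i f ys))))

  -- Sums over the sublists of a given length.

  -- `sumSubsets` freed from `FinSet`, so that lists can be taken apart; on `elements A` the two
  -- agree definitionally.
  sumCombinations : List A → (k : ℕ) → (Vec A k → Carrier) → Carrier
  sumCombinations xs k g = foldr (λ J s → g J ∙ s) ε (combinations k xs)

  private
    foldr-cong : ∀ {g h : A → Carrier} → (∀ J → g J ≈ h J) → ∀ Js →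
                 foldr (λ J s → g J ∙ s) ε Js ≈ foldr (λ J s → h J ∙ s) ε Js
    foldr-cong g≈h []       = ≈-refl
    foldr-cong g≈h (J ∷ Js) = ∙-cong (g≈h J) (foldr-cong g≈h Js)

    foldr-∙ : ∀ (g : A → Carrier) s Js → foldr (λ J t → g J ∙ t) s Js ≈ foldr (λ J t → g J ∙ t) ε Js ∙ s
    foldr-∙ g s []       = ≈-sym (identityˡ s)
    foldr-∙ g s (J ∷ Js) = ≈-trans (∙-congˡ (foldr-∙ g s Js)) (≈-sym (assoc _ _ s))

  sumCombinations-cong : ∀ (xs : List A) {g h : Vec A k → Carrier} → (∀ J → g J ≈ h J) →
                         sumCombinations xs k g ≈ sumCombinations xs k h
  sumCombinations-cong xs g≈h = foldr-cong g≈h (combinations _ xs)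

  -- The analogue of Pascal's rule: a sublist either contains the head or omits it.
  sumCombinations-∷ : ∀ y (xs : List A) (g : Vec A (suc k) → Carrier) →
    sumCombinations (y ∷ xs) (suc k) g ≈
    sumCombinations xs k (λ J → g (y ∷ J)) ∙ sumCombinations xs (suc k) g
  sumCombinations-∷ {k = k} y xs g = begin
    foldr step ε (List.map (y ∷_) (combinations k xs) ++ combinations (suc k) xs)
      ≡⟨ foldr-++ step ε (List.map (y ∷_) (combinations k xs)) _ ⟩
    foldr step (sumCombinations xs (suc k) g) (List.map (y ∷_) (combinations k xs))
      ≡⟨ foldr-map step (y ∷_) _ (combinations k xs) ⟩
    foldr (λ J s → g (y ∷ J) ∙ s) (sumCombinations xs (suc k) g) (combinations k xs)
      ≈⟨ foldr-∙ _ _ (combinations k xs) ⟩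
    sumCombinations xs k (λ J → g (y ∷ J)) ∙ sumCombinations xs (suc k) g ∎
    where step = λ J s → g J ∙ s

  -- Rearranging a list only changes the order of its sublists and of the entries within them;
  -- commutativity absorbs the first, symmetry of `g` the second. The induction is on the
  -- rearrangement.
  sumCombinations-↭ : {xs ys : List A} → xs ↭ ys → {g : Vec A k → Carrier} → IsSymmetric G g →
                      sumCombinations xs k g ≈ sumCombinations ys k g
  sumCombinations-↭ {k = zero}  _         sym = ≈-refl
  sumCombinations-↭ {k = suc k} Perm.refl sym = ≈-refl
  sumCombinations-↭ {k = suc k} (Perm.trans xs↭ys ys↭zs) sym =
    ≈-trans (sumCombinations-↭ xs↭ys sym) (sumCombinations-↭ ys↭zs sym)
  sumCombinations-↭ {k = suc k} (Perm.prep {xs} {ys} y xs↭ys) {g} sym = begin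
    sumCombinations (y ∷ xs) (suc k) g
      ≈⟨ sumCombinations-∷ y xs g ⟩
    sumCombinations xs k (λ J → g (y ∷ J)) ∙ sumCombinations xs (suc k) g
      ≈⟨ ∙-cong (sumCombinations-↭ xs↭ys (IsSymmetric-∷ sym y)) (sumCombinations-↭ xs↭ys sym) ⟩
    sumCombinations ys k (λ J → g (y ∷ J)) ∙ sumCombinations ys (suc k) g
      ≈⟨ sumCombinations-∷ y ys g ⟨
    sumCombinations (y ∷ ys) (suc k) g ∎
  -- A sublist of length one cannot contain both `y` and `z`, so this case has no `both` term.
  sumCombinations-↭ {k = suc zero} (Perm.swap {xs} {ys} y z xs↭ys) {g} sym = begin
    g (y ∷ []) ∙ (g (z ∷ []) ∙ sumCombinations xs 1 g)
      ≈⟨ x∙yz≈y∙xz _ _ _ ⟩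
    g (z ∷ []) ∙ (g (y ∷ []) ∙ sumCombinations xs 1 g)
      ≈⟨ ∙-congˡ (∙-congˡ (sumCombinations-↭ xs↭ys sym)) ⟩
    g (z ∷ []) ∙ (g (y ∷ []) ∙ sumCombinations ys 1 g) ∎
  sumCombinations-↭ {k = suc (suc k)} (Perm.swap {xs} {ys} y z xs↭ys) {g} sym = begin
    sumCombinations (y ∷ z ∷ xs) (suc (suc k)) g
      ≈⟨ expand y z xs ⟩
    (both y z xs ∙ only y xs) ∙ (only z xs ∙ neither xs)
      ≈⟨ interchange _ _ _ _ ⟩
    (both y z xs ∙ only z xs) ∙ (only y xs ∙ neither xs)
      ≈⟨ ∙-cong
           (∙-cong
             (≈-trans
               -- Sublists containing both `y` and `z` list them in opposite orders on the two
               -- sides; symmetry of `g` exchanges these two entries.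
               (sumCombinations-cong xs (λ J → IsSymmetric-↭ᶠ sym (swap-↭ᶠ y z J)))
               (sumCombinations-↭ xs↭ys (IsSymmetric-∷ (IsSymmetric-∷ sym z) y)))
             (sumCombinations-↭ xs↭ys (IsSymmetric-∷ sym z)))
           (∙-cong (sumCombinations-↭ xs↭ys (IsSymmetric-∷ sym y)) (sumCombinations-↭ xs↭ys sym)) ⟩
    (both z y ys ∙ only z ys) ∙ (only y ys ∙ neither ys)
      ≈⟨ expand z y ys ⟨
    sumCombinations (z ∷ y ∷ ys) (suc (suc k)) g ∎
    where
    both : _ → _ → List _ → Carrier
    both u v ws = sumCombinations ws k (λ J → g (u ∷ v ∷ J))
    only : _ → List _ → Carrier
    only u ws = sumCombinations ws (suc k) (λ J → g (u ∷ J))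
    neither : List _ → Carrier
    neither ws = sumCombinations ws (suc (suc k)) g
    expand : ∀ u v ws → sumCombinations (u ∷ v ∷ ws) (suc (suc k)) g ≈
                        (both u v ws ∙ only u ws) ∙ (only v ws ∙ neither ws)
    expand u v ws = ≈-trans (sumCombinations-∷ u (v ∷ ws) g)
      (∙-cong (sumCombinations-∷ v ws (λ J → g (u ∷ J))) (sumCombinations-∷ v ws g))

  -- The only subset of full size is `B` itself, so the sum has a single term.
  sumSubsets-full : ∀ B (eq : size B ≡ k) (g : Vec ℕ k → Carrier) → sumSubsets G B k g ≈ g (listing B eq)
  sumSubsets-full B eq g rewrite combinations-full (elements B) eq = identityʳ _

  -- Cancellation and telescoping.

  -//-cancelʳ : ∀ x y z → (x ∙ z) - (y ∙ z) ≈ x - y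
  -//-cancelʳ x y z = begin
    (x ∙ z) ∙ (y ∙ z) ⁻¹    ≈⟨ ∙-congˡ (⁻¹-∙-comm y z) ⟨
    (x ∙ z) ∙ (y ⁻¹ ∙ z ⁻¹) ≈⟨ interchange x z (y ⁻¹) (z ⁻¹) ⟩
    (x - y) ∙ (z ∙ z ⁻¹)    ≈⟨ ∙-congˡ (inverseʳ z) ⟩
    (x - y) ∙ ε             ≈⟨ identityʳ _ ⟩
    x - y                   ∎

  sum-telescope : ∀ n (h : ℕ → Carrier) →
    sum commutativeMonoid {n} (λ i → h (suc (toℕ i)) - h (toℕ i)) ≈ h n - h 0
  sum-telescope zero    h = ≈-sym (inverseʳ (h 0))
  sum-telescope (suc n) h = begin
    (h 1 - h 0) ∙ sum commutativeMonoid {n} (λ i → h (suc (suc (toℕ i))) - h (suc (toℕ i)))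
      ≈⟨ ∙-congˡ (sum-telescope n (λ i → h (suc i))) ⟩
    (h 1 - h 0) ∙ (h (suc n) - h 1)
      ≈⟨ comm _ _ ⟩
    (h (suc n) - h 1) ∙ (h 1 - h 0)
      ≈⟨ assoc _ _ _ ⟨
    ((h (suc n) - h 1) ∙ h 1) - h 0
      ≈⟨ ∙-congʳ (//-rightDividesˡ (h 1) (h (suc n))) ⟩
    h (suc n) - h 0 ∎

-- Apéry sets along the chain of semigroups.

module _ (S : NumericalSemigroup) (m : ℕ) .{{_ : NonZero m}} (m∈S : m ∈ₛ S)
         {n : ℕ} (c : Fin n → ℕ) (gaps : IsGapEnumeration S c) where

  open Chain S m m∈S c gaps
  open IsGapEnumeration gaps

  private
    gap∉S : ∀ i → c i ∉ₛ S
    gap∉S i = Equivalence.from (enumerates (c i)) (i , refl)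

    c-reflects-< : ∀ {i j} → c i < c j → toℕ i < toℕ j
    c-reflects-< {i} {j} ci<cj with <-cmp (toℕ i) (toℕ j)
    ... | tri< i<j _ _ = i<j
    ... | tri≈ _ i≡j _ = ⊥-elim (<-irrefl (≡.cong c (toℕ-injective i≡j)) ci<cj)
    ... | tri> _ _ j<i = ⊥-elim (<-asym ci<cj (increasing j<i))

    gap<gap+m : ∀ i → c i < c i + m
    gap<gap+m i = m<m+n (c i) (>-nonZero⁻¹ m)

  -- Since `c` is indexed from zero, `chain (toℕ i)` is the semigroup just before the gap `c i` is
  -- removed, and `chain (suc (toℕ i))` the one just after.
  chain-suc : ∀ i {t} → t ∈ₛ chain (suc (toℕ i)) ⇔ (t ∈ₛ chain (toℕ i) × t ≢ c i)
  chain-suc i {t} = mk⇔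
    (λ t∈ → (λ j j<i → t∈ j (≤-trans j<i (n≤1+n _))) , t∈ i ≤-refl)
    (λ (t∈ , t≢ci) j j<1+i → split t∈ t≢ci j (m≤n⇒m<n∨m≡n (s≤s⁻¹ j<1+i)))
    where
    split : t ∈ₛ chain (toℕ i) → t ≢ c i → ∀ j → toℕ j < toℕ i ⊎ toℕ j ≡ toℕ i → t ≢ c j
    split t∈ t≢ci j (inj₁ j<i) = t∈ j j<i
    split t∈ t≢ci j (inj₂ j≡i) t≡cj = t≢ci (≡.trans t≡cj (≡.cong c (toℕ-injective j≡i)))

  gap∈chain : ∀ i → c i ∈ₛ chain (toℕ i)
  gap∈chain i j j<i ci≡cj = <-irrefl (≡.sym ci≡cj) (increasing j<i)

  -- If `c i ∸ m` were in the chain, it would be in `S`, being smaller than every gap not yet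
  -- removed; adding `m` would then put the gap `c i` into `S`.
  gap∈apéry : ∀ i → c i ∈ elements (apéry (chain (toℕ i)) m)
  gap∈apéry i = Equivalence.from (∈-apéry (chain (toℕ i)) m) (gap∈chain i , notin)
    where
    notin : m ≤ c i → c i ∸ m ∉ₛ chain (toℕ i)
    notin m≤ci ci-m∈ = gap∉S i (subst (_∈ₛ S) (m∸n+n≡m m≤ci) (+-closed S ci-m∈S m∈S))
      where
      ci-m∈S : c i ∸ m ∈ₛ S
      ci-m∈S = decidable-stable (member? S _) λ ci-m∉S →
        let j , cj≡ = Equivalence.to (enumerates _) ci-m∉S in
        -- A gap `c j` equal to `c i ∸ m` is smaller than `c i`, hence already removed.
        ci-m∈ j (c-reflects-< (subst (_< c i) (≡.sym cj≡) (∸-monoʳ-< (>-nonZero⁻¹ m) m≤ci))) (≡.sym cj≡)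

  -- `c i + m` exceeds every gap removed so far, while `c i` itself has just been removed.
  gap+m∈apéry : ∀ i → c i + m ∈ elements (apéry (chain (suc (toℕ i))) m)
  gap+m∈apéry i = Equivalence.from (∈-apéry (chain (suc (toℕ i))) m)
    ( (λ j j<1+i ci+m≡cj → <⇒≱ (c-reflects-< (subst (c i <_) ci+m≡cj (gap<gap+m i))) (s≤s⁻¹ j<1+i))
    , λ _ ci∈ → ci∈ i ≤-refl (m+n∸n≡m (c i) m))

  apéry-suc : ∀ i → elements (apéry (chain (suc (toℕ i))) m) ↭ (c i + m) ∷ elements (T i)
  apéry-suc i = ∖-insert (apéry (chain (suc (toℕ i))) m) (gap+m∈apéry i)

  -- Removing `c i` from the semigroup changes the Apéry condition at `t` only if `t` or `t ∸ m`
  -- equals `c i`, and both of these values of `t` are excluded from the two sets.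
  T-alternative : ∀ i → elements (apéry (chain (toℕ i)) m ∖ c i) ↭ elements (T i)
  T-alternative i = unique∧set⇒↭ (unique (apéry S⁻ m ∖ c i)) (unique (T i)) (mk⇔
    (λ t∈ → let t∈apéry , t≢ci = Equivalence.to (∈-∖ (apéry S⁻ m)) t∈ in
            Equivalence.from (∈-∖ (apéry S⁺ m)) (to (Equivalence.to (∈-apéry S⁻ m) t∈apéry) t≢ci))
    (λ t∈ → let t∈apéry , t≢ci+m = Equivalence.to (∈-∖ (apéry S⁺ m)) t∈ in
            Equivalence.from (∈-∖ (apéry S⁻ m)) (from (Equivalence.to (∈-apéry S⁺ m) t∈apéry) t≢ci+m)))
    where
    S⁻ = chain (toℕ i)
    S⁺ = chain (suc (toℕ i))
    to : ∀ {t} → IsApéry S⁻ m t → t ≢ c i → t ∈ elements (apéry S⁺ m) × t ≢ c i + m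
    to {t} (t∈ , t-m∉) t≢ci =
      Equivalence.from (∈-apéry S⁺ m)
        ( Equivalence.from (chain-suc i) (t∈ , t≢ci)
        , λ m≤t t-m∈ → t-m∉ m≤t (proj₁ (Equivalence.to (chain-suc i) t-m∈)))
      -- For `t` equal to `c i + m`, `t ∸ m` is `c i`, which still lies in `S⁻`.
      , λ { refl → t-m∉ (m≤n+m m (c i)) (subst (_∈ₛ S⁻) (≡.sym (m+n∸n≡m (c i) m)) (gap∈chain i)) }
    from : ∀ {t} → IsApéry S⁺ m t → t ≢ c i + m → t ∈ elements (apéry S⁻ m) × t ≢ c i
    from {t} (t∈ , t-m∉) t≢ci+m =
      Equivalence.from (∈-apéry S⁻ m) (t∈S⁻ , λ m≤t t-m∈ → t-m∉ m≤t
        (Equivalence.from (chain-suc i) (t-m∈ , λ t-m≡ci →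
          t≢ci+m (≡.trans (≡.sym (m∸n+n≡m m≤t)) (≡.cong (_+ m) t-m≡ci)))))
      , t≢ci
      where
      t∈S⁻ = proj₁ (Equivalence.to (chain-suc i) t∈)
      t≢ci = proj₂ (Equivalence.to (chain-suc i) t∈)

  apéry-toℕ : ∀ i → elements (apéry (chain (toℕ i)) m) ↭ c i ∷ elements (T i)
  apéry-toℕ i = Perm.↭-trans (∖-insert (apéry (chain (toℕ i)) m) (gap∈apéry i)) (Perm.↭-prep (c i) (T-alternative i))

  -- `chain 0` has no gaps, so an Apéry element cannot be `m` or more: subtracting `m` would stay
  -- inside.
  apéry-chain-0 : elements (apéry (chain 0) m) ↭ elements (I m)
  apéry-chain-0 = unique∧set⇒↭ (unique (apéry (chain 0) m)) (unique (I m)) (mk⇔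
    (λ t∈ → ∈-upTo⁺ (≰⇒> λ m≤t → proj₂ (Equivalence.to (∈-apéry (chain 0) m) t∈) m≤t λ _ ()))
    (λ t∈ → Equivalence.from (∈-apéry (chain 0) m) ((λ _ ()) , λ m≤t → ⊥-elim (<⇒≱ (∈-upTo⁻ t∈) m≤t))))

  chain-n : ∀ {t} → t ∈ₛ chain n ⇔ t ∈ₛ S
  chain-n {t} = mk⇔
    (λ t∈ → decidable-stable (member? S t) λ t∉S →
      let j , cj≡t = Equivalence.to (enumerates t) t∉S in t∈ j (toℕ<n j) (≡.sym cj≡t))
    (λ t∈S j _ t≡cj → gap∉S j (subst (_∈ₛ S) t≡cj t∈S))

  -- `chain n` and `S` are different records with equivalent membership, so their Apéry sets agree
  -- only up to rearrangement.
  apéry-chain-n : elements (apéry (chain n) m) ↭ elements (apéry S m)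
  apéry-chain-n = unique∧set⇒↭ (unique (apéry (chain n) m)) (unique (apéry S m)) (mk⇔
    (λ t∈ → let t∈chain , t-m∉ = Equivalence.to (∈-apéry (chain n) m) t∈ in
      Equivalence.from (∈-apéry S m)
        (Equivalence.to chain-n t∈chain , λ m≤t → t-m∉ m≤t ∘ Equivalence.from chain-n))
    (λ t∈ → let t∈S , t-m∉ = Equivalence.to (∈-apéry S m) t∈ in
      Equivalence.from (∈-apéry (chain n) m)
        (Equivalence.from chain-n t∈S , λ m≤t → t-m∉ m≤t ∘ Equivalence.to chain-n)))

  -- The summation identity and its case `p` equal to `m`.

  module _ {X : Set x} (f : ℕ → X) (G : AbelianGroup a ℓ) where

    open AbelianGroup G renaming (refl to ≈-refl; sym to ≈-sym; trans to ≈-trans)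
    open import Relation.Binary.Reasoning.Setoid setoid

    sumSubsets-insert : ∀ {q} {F : Vec X (suc q) → Carrier} → IsSymmetric G F →
      ∀ {B} C {u} → elements B ↭ u ∷ elements C →
      sumSubsets G C q (λ J → F (append (map f J) (f u))) ∙ sumSubsets G C (suc q) (λ J → F (map f J))
        ≈ sumSubsets G B (suc q) (λ J → F (map f J))
    sumSubsets-insert {q} {F} sym {B} C {u} B↭u∷C = begin
      sumSubsets G C q (λ J → F (append (map f J) (f u))) ∙ sumSubsets G C (suc q) (λ J → F (map f J))
        ≈⟨ ∙-congʳ (sumCombinations-cong G (elements C)
             λ J → IsSymmetric-↭ᶠ G sym (∷ʳ-↭ᶠ-∷ (map f J) (f u))) ⟩
      sumSubsets G C q (λ J → F (map f (u ∷ J))) ∙ sumSubsets G C (suc q) (λ J → F (map f J))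
        ≈⟨ sumCombinations-∷ G u (elements C) (λ J → F (map f J)) ⟨
      sumCombinations G (u ∷ elements C) (suc q) (λ J → F (map f J))
        ≈⟨ sumCombinations-↭ G B↭u∷C (IsSymmetric-map G sym f) ⟨
      sumSubsets G B (suc q) (λ J → F (map f J)) ∎

    sum-sumSubsets : ∀ p .{{_ : NonZero p}} (F : Vec X p → Carrier) → IsSymmetric G F →
      sum commutativeMonoid (λ i →
          sumSubsets G (T i) (pred p) (λ J → F (append (map f J) (f (c i + m))))
        - sumSubsets G (T i) (pred p) (λ J → F (append (map f J) (f (c i)))))
      ≈ sumSubsets G (apéry S m) p (λ J → F (map f J)) - sumSubsets G (I m) p (λ J → F (map f J))
    -- Matching on `p` lets `pred p` and `append` compute.
    sum-sumSubsets p@(suc q) F sym = begin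
      sum commutativeMonoid (λ i → Σᵀ i (c i + m) - Σᵀ i (c i))
        ≈⟨ Sum.sum-cong-≋ commutativeMonoid summand ⟩
      sum commutativeMonoid {n} (λ i → Φ (suc (toℕ i)) - Φ (toℕ i))
        ≈⟨ sum-telescope G n Φ ⟩
      Φ n - Φ 0
        ≈⟨ ∙-cong (sumCombinations-↭ G apéry-chain-n (IsSymmetric-map G sym f))
                  (⁻¹-cong (sumCombinations-↭ G apéry-chain-0 (IsSymmetric-map G sym f))) ⟩
      sumSubsets G (apéry S m) p (λ J → F (map f J)) - sumSubsets G (I m) p (λ J → F (map f J)) ∎
      where
      Φ : ℕ → Carrier
      Φ k = sumSubsets G (apéry (chain k) m) p (λ J → F (map f J))
      Σᵀ : Fin n → ℕ → Carrier
      Σᵀ i u = sumSubsets G (T i) q (λ J → F (append (map f J) (f u)))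
      summand : ∀ i → Σᵀ i (c i + m) - Σᵀ i (c i) ≈ Φ (suc (toℕ i)) - Φ (toℕ i)
      summand i = ≈-trans
        -- The sum over the `p`-subsets of `T i` is added to both terms of the difference,
        -- completing each to a full Apéry set.
        (≈-sym (-//-cancelʳ G _ _ (sumSubsets G (T i) p (λ J → F (map f J)))))
        (∙-cong (sumSubsets-insert sym {apéry (chain (suc (toℕ i))) m} (T i) (apéry-suc i))
                (⁻¹-cong (sumSubsets-insert sym {apéry (chain (toℕ i)) m} (T i) (apéry-toℕ i))))

    -- For `p` equal to `m` every subset sum has one term: `T i` has `pred m` elements, while the
    -- Apéry set of `S` and `I m` have `m` each.
    sum-listing : ∀ (F : Vec X m → Carrier) → IsSymmetric G F →
      sum commutativeMonoid (λ i →
          F (append (map f (listing (T i) (T-size i))) (f (c i + m)))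
        - F (append (map f (listing (T i) (T-size i))) (f (c i))))
      ≈ F (map f (listing (apéry S m) (apéry-size S m m∈S)))
        - F (map f (listing (I m) (I-size m)))
    sum-listing F sym = ≈-trans
      (Sum.sum-cong-≋ commutativeMonoid λ i → ≈-sym (∙-cong
        (sumSubsets-full G (T i) (T-size i) _)
        (⁻¹-cong (sumSubsets-full G (T i) (T-size i) _))))
      (≈-trans (sum-sumSubsets m F sym) (∙-cong
        (sumSubsets-full G (apéry S m) (apéry-size S m m∈S) _)
        (⁻¹-cong (sumSubsets-full G (I m) (I-size m) _))))

mainTheorem7 :
  ∀ {x a ℓ : Level} (S : NumericalSemigroup) → ¬ (∀ k → k ∈ₛ S) →
  ∀ (m : ℕ) .{{_ : NonZero m}} (m∈S : m ∈ₛ S)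
    {n : ℕ} (c : Fin n → ℕ) (gaps : IsGapEnumeration S c)
    (X : Set x) (f : ℕ → X) (G : AbelianGroup a ℓ) →
  let open Chain S m m∈S c gaps
      open AbelianGroup G
      Σ⊆ = sumSubsets G
  in
  (∀ (p : ℕ) .{{_ : NonZero p}} → p ≤ m →
   ∀ (F : Vec X p → Carrier) → IsSymmetric G F →
     sum commutativeMonoid (λ i →
         Σ⊆ (T i) (pred p) (λ J → F (append (map f J) (f (c i + m))))
       - Σ⊆ (T i) (pred p) (λ J → F (append (map f J) (f (c i)))))
     ≈ Σ⊆ (apéry S m) p (λ J → F (map f J)) - Σ⊆ (I m) p (λ J → F (map f J)))
  ×
  (∀ (F : Vec X m → Carrier) → IsSymmetric G F →
     sum commutativeMonoid (λ i →
         F (append (map f (listing (T i) (T-size i))) (f (c i + m)))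
       - F (append (map f (listing (T i) (T-size i))) (f (c i))))
     ≈ F (map f (listing (apéry S m) (apéry-size S m m∈S)))
       - F (map f (listing (I m) (I-size m))))
mainTheorem7 S _ m m∈S c gaps X f G =
  (λ p _ → sum-sumSubsets S m m∈S c gaps f G p) , sum-listing S m m∈S c gaps f G
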